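{- Let $k\ge 2$ and let $\mathcal{F}=(V,\mathcal{E})$ be a $k$-uniform edge-maximal hypertree of order $n=|V|\ge k-1$. Then $$|\mathcal{E}|\ge \frac{1}{k(k-1)}\cdot\frac{n-k+1}{n-k+2}\binom{n}{k-1}.$$
   Context: A $k$-uniform hypergraph $\mathcal{H}=(V,\mathcal{E})$ consists of a finite vertex set $V$ and a set $\mathcal{E}$ of $k$-element subsets of $V$ (no multiple edges). A $k$-uniform hypergraph is a chain if there is a sequence $v_1,\dots,v_l$ of its vertices in which every vertex appears at least once (possibly more times), $v_1\ne v_l$, and its edge set consists of exactly the $l-k+1$ distinct sets $\{v_i,\dots,v_{i+k-1}\}$, $1\le i\le l-k+1$; it is a semicycle if the same holds with $v_1=v_l$ instead. $\mathcal{H}$ is chain-connected if every pair of distinct vertices is contained in some subhypergraph of $\mathcal{H}$ that is a chain; semicycle-free if no subhypergraph is a semicycle. A hypertree is a chain-connected, semicycle-free $k$-uniform hypergraph. An edge-maximal hypertree is a hypertree $(V,\mathcal{E})$ such that for every $k$-subset $e\subseteq V$ with $e\notin\mathcal{E}$, the hypergraph $(V,\mathcal{E}\cup\{e\})$ is not a hypertree. -}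

module Defs where

open import Data.Nat using (ℕ; zero; suc; _+_; _*_; _∸_; _≤_)
open import Data.Nat.Combinatorics using (_C_)
open import Data.Fin using (Fin)
open import Data.Fin.Subset using (Subset; ⁅_⁆; _∪_; ⊥; ∣_∣; _∈_)
open import Data.List using (List; []; _∷_; length; map; take; drop; upTo; head; last; foldr)
open import Data.List.Relation.Unary.All using (All)
open import Data.List.Relation.Unary.All.Properties.Core using (¬Any⇒All¬)
open import Data.List.Relation.Unary.Unique.Propositional using (Unique)
import Data.List.Membership.Propositional as LMem
open import Data.Maybe using (Maybe)
open import Data.Product using (Σ; _×_; ∃)
open import Relation.Binary.PropositionalEquality using (_≡_; _≢_)
open import Relation.Nullary using (¬_)

record Hypergraph (k n : ℕ) : Set where
  field
    edges   : List (Subset n)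
    uniform : All (λ e → ∣ e ∣ ≡ k) edges
    simple  : Unique edges
open Hypergraph public

toSubset : ∀ {n} → List (Fin n) → Subset n
toSubset = foldr (λ v s → ⁅ v ⁆ ∪ s) ⊥

windows : ∀ {n} → ℕ → List (Fin n) → List (Subset n)
windows k s = map (λ i → toSubset (take k (drop i s))) (upTo (suc (length s ∸ k)))

-- The sequence s determines a sub-hypergraph of edge set E (vertex set = entries
-- of s) whose edges are exactly the l-k+1 pairwise distinct k-sets given by the windows.
IsWalkIn : ∀ {n} (k : ℕ) (E : List (Subset n)) → List (Fin n) → Set
IsWalkIn k E s =
  k ≤ length s
  × All (λ w → ∣ w ∣ ≡ k) (windows k s)
  × All (λ w → w LMem.∈ E) (windows k s)
  × Unique (windows k s)

IsChainIn : ∀ {n} (k : ℕ) (E : List (Subset n)) → List (Fin n) → Set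
IsChainIn k E s = IsWalkIn k E s × head s ≢ last s

IsSemicycleIn : ∀ {n} (k : ℕ) (E : List (Subset n)) → List (Fin n) → Set
IsSemicycleIn k E s = IsWalkIn k E s × head s ≡ last s

ChainConnected : ∀ {k n} → Hypergraph k n → Set
ChainConnected {k} {n} H =
  (u v : Fin n) → u ≢ v →
  Σ (List (Fin n)) λ s → IsChainIn k (edges H) s × u ∈ toSubset s × v ∈ toSubset s

SemicycleFree : ∀ {k n} → Hypergraph k n → Set
SemicycleFree {k} {n} H = (s : List (Fin n)) → ¬ IsSemicycleIn k (edges H) s

IsHypertree : ∀ {k n} → Hypergraph k n → Set
IsHypertree H = ChainConnected H × SemicycleFree H

addEdge : ∀ {k n} (H : Hypergraph k n) (e : Subset n) → ∣ e ∣ ≡ k →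
          ¬ (e LMem.∈ edges H) → Hypergraph k n
addEdge H e he e∉ = record
  { edges = e ∷ edges H
  ; uniform = he All.∷ uniform H
  ; simple = (¬Any⇒All¬ (edges H) e∉) Data.List.Relation.Unary.AllPairs.∷ simple H
  }
  where import Data.List.Relation.Unary.AllPairs
        import Data.List.Relation.Unary.All as All

IsEdgeMaximalHypertree : ∀ {k n} → Hypergraph k n → Set
IsEdgeMaximalHypertree {k} {n} H =
  IsHypertree H ×
  ((e : Subset n) (he : ∣ e ∣ ≡ k) (e∉ : ¬ (e LMem.∈ edges H)) →
     ¬ IsHypertree (addEdge H e he e∉))

{-# OPTIONS --safe #-}

-- Write k = r + 1 and m = n − r.  If a k-set e is not an edge, then adding it to the hypertree
-- creates a semicycle, which has at least two windows and e among them.  A window next to e is an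
-- edge sharing r vertices with e, so every k-set contains an r-set covered by an edge.  There are
-- at most k |E| covered r-sets, and de Caen's bound for the Turán problem says that a family of s
-- r-sets meeting every k-set in this way satisfies m (n C r) ≤ r (m + 1) s.
--
-- De Caen's bound counts the pairs (A , A′) of r-sets with A outside and A′ inside the family that
-- differ by the exchange of one vertex.  Each A lies in at least m of them.  If D is the number of
-- family members containing the (r − 1)-set A ∩ A′ and d = m + 1 − D, then their number is also the
-- sum of d D over all (r − 1)-sets, and a linear upper bound for d D gives the result.
module Submission where

open import Defs
open import Data.Bool using (Bool; true; false; not)
import Data.Bool.Properties as Bool
open import Data.Fin using (Fin; zero; suc; fromℕ<)
open import Data.Fin.Properties using (any?; toℕ-fromℕ<)
open import Data.Fin.Subset using (Subset; inside; outside; ∣_∣; _∈_; ⁅_⁆; _∪_)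
open import Data.Fin.Subset.Properties
  using (∪-identityˡ; ∪-assoc; ∪-comm; x∈⁅x⁆; x∈p∪q⁺; ∣⊥∣≡0; _∈?_)
open import Data.List as List using (List; []; _∷_; _∷ʳ_; length; take; drop; applyUpTo; head; last)
import Data.List.Membership.DecPropositional as DecMembership
open import Data.List.Membership.Propositional using () renaming (_∈_ to _∈ᴸ_)
open import Data.List.Properties using (map-upTo; length-take; take-all; take-suc)
open import Data.List.Relation.Unary.All as All using (All; []; _∷_)
import Data.List.Relation.Unary.All.Properties as All
open import Data.List.Relation.Unary.AllPairs using (AllPairs; []; _∷_)
open import Data.List.Relation.Unary.Any using (here; there)
open import Data.List.Relation.Unary.Unique.Propositional using (Unique)
open import Data.Maybe using (just)
open import Data.Nat using (ℕ; zero; suc; _+_; _*_; _∸_; _≤_; _<_; z≤n; s≤s)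
open import Data.Nat.Combinatorics using (_C_; nCk+nC[k+1]≡[n+1]C[k+1])
open import Data.Nat.Properties
open import Data.Nat.Tactic.RingSolver using (solve-∀)
open import Algebra.Properties.Semiring.Sum +-*-semiring
  using (sum; sum-cong-≗; ∑-distrib-+; ∑-comm; *-distribˡ-sum; *-distribʳ-sum)
open import Data.Product using (∃; _×_; _,_)
open import Data.Sum using (inj₁; inj₂)
open import Data.Vec using ([]; _∷_; lookup; _[_]≔_)
open import Data.Vec.Properties
  using (≡-dec; []≔-lookup; []≔-idempotent; []≔-commutes; lookup∘update; lookup∘update′;
         []=⇒lookup; lookup⇒[]=)
open import Function using (_∘_)
open import Level using (Level)
open import Relation.Binary.Core using (Rel)
open import Relation.Binary.Definitions using (DecidableEquality)
open import Relation.Binary.PropositionalEquality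
  using (_≡_; _≢_; refl; sym; trans; cong; cong₂; subst; module ≡-Reasoning)
open import Relation.Nullary using (¬_; yes; no; does; contradiction)
open import Relation.Nullary.Decidable using (dec-true; dec-false; _×-dec_; decidable-stable)
open import Relation.Unary using (Pred; Decidable)

private variable
  n : ℕ
  ℓ : Level

-- Sums over all subsets of a finite vertex set.

ι : Bool → ℕ
ι true  = 1
ι false = 0

ι-+-not : ∀ b → ι b + ι (not b) ≡ 1
ι-+-not true  = refl
ι-+-not false = refl

∑ˢ : (Subset n → ℕ) → ℕ
∑ˢ {zero}  f = f []
∑ˢ {suc n} f = ∑ˢ (f ∘ (outside ∷_)) + ∑ˢ (f ∘ (inside ∷_))

sum-mono-≤ : {f g : Fin n → ℕ} → (∀ x → f x ≤ g x) → sum f ≤ sum g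
sum-mono-≤ {zero}  f≤g = z≤n
sum-mono-≤ {suc n} f≤g = +-mono-≤ (f≤g zero) (sum-mono-≤ (f≤g ∘ suc))

term≤sum : (f : Fin n → ℕ) → ∀ x → f x ≤ sum f
term≤sum f zero    = m≤m+n _ _
term≤sum f (suc x) = ≤-trans (term≤sum (f ∘ suc) x) (m≤n+m _ _)

∑ˢ-cong : {f g : Subset n → ℕ} → (∀ A → f A ≡ g A) → ∑ˢ f ≡ ∑ˢ g
∑ˢ-cong {zero}  f≡g = f≡g []
∑ˢ-cong {suc n} f≡g = cong₂ _+_ (∑ˢ-cong (f≡g ∘ (outside ∷_))) (∑ˢ-cong (f≡g ∘ (inside ∷_)))

∑ˢ-mono-≤ : {f g : Subset n → ℕ} → (∀ A → f A ≤ g A) → ∑ˢ f ≤ ∑ˢ g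
∑ˢ-mono-≤ {zero}  f≤g = f≤g []
∑ˢ-mono-≤ {suc n} f≤g = +-mono-≤ (∑ˢ-mono-≤ (f≤g ∘ (outside ∷_))) (∑ˢ-mono-≤ (f≤g ∘ (inside ∷_)))

∑ˢ-distrib-+ : (f g : Subset n → ℕ) → ∑ˢ (λ A → f A + g A) ≡ ∑ˢ f + ∑ˢ g
∑ˢ-distrib-+ {zero}  f g = refl
∑ˢ-distrib-+ {suc n} f g
  rewrite ∑ˢ-distrib-+ (f ∘ (outside ∷_)) (g ∘ (outside ∷_))
        | ∑ˢ-distrib-+ (f ∘ (inside ∷_)) (g ∘ (inside ∷_))
  = +-interchange (∑ˢ (f ∘ (outside ∷_))) (∑ˢ (g ∘ (outside ∷_))) _ _
  where
  +-interchange : ∀ a b c d → a + b + (c + d) ≡ a + c + (b + d)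
  +-interchange = solve-∀

*-distribˡ-∑ˢ : ∀ c (f : Subset n → ℕ) → ∑ˢ (λ A → c * f A) ≡ c * ∑ˢ f
*-distribˡ-∑ˢ {zero}  c f = refl
*-distribˡ-∑ˢ {suc n} c f
  rewrite *-distribˡ-∑ˢ c (f ∘ (outside ∷_)) | *-distribˡ-∑ˢ c (f ∘ (inside ∷_))
  = sym (*-distribˡ-+ c _ _)

∑ˢ-zero : ∑ˢ {n} (λ _ → 0) ≡ 0
∑ˢ-zero {zero}  = refl
∑ˢ-zero {suc n} = cong₂ _+_ (∑ˢ-zero {n}) (∑ˢ-zero {n})

∑ˢ-sum-comm : ∀ {m} (f : Subset n → Fin m → ℕ) →
              ∑ˢ (λ A → sum (f A)) ≡ sum (λ x → ∑ˢ (λ A → f A x))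
∑ˢ-sum-comm {zero}  f = refl
∑ˢ-sum-comm {suc n} f
  rewrite ∑ˢ-sum-comm (f ∘ (outside ∷_)) | ∑ˢ-sum-comm (f ∘ (inside ∷_))
  = sym (∑-distrib-+ (λ x → ∑ˢ (λ A → f (outside ∷ A) x)) _)

∑ˢ-single : (f : Subset n → ℕ) (B : Subset n) → (∀ A → A ≢ B → f A ≡ 0) → ∑ˢ f ≡ f B
∑ˢ-single {zero}  f [] f≡0 = refl
∑ˢ-single {suc n} f (outside ∷ B) f≡0
  rewrite ∑ˢ-single (f ∘ (outside ∷_)) B (λ A A≢B → f≡0 _ λ { refl → A≢B refl })
        | ∑ˢ-cong {f = f ∘ (inside ∷_)} {λ _ → 0} (λ A → f≡0 _ λ ()) | ∑ˢ-zero {n}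
  = +-identityʳ _
∑ˢ-single {suc n} f (inside ∷ B) f≡0
  rewrite ∑ˢ-single (f ∘ (inside ∷_)) B (λ A A≢B → f≡0 _ λ { refl → A≢B refl })
        | ∑ˢ-cong {f = f ∘ (outside ∷_)} {λ _ → 0} (λ A → f≡0 _ λ ()) | ∑ˢ-zero {n}
  = refl

-- Adding and deleting a vertex, and double counting along inclusions.

infixl 7 _⊹_ _⊝_

_⊹_ _⊝_ : Subset n → Fin n → Subset n
A ⊹ x = A [ x ]≔ inside
A ⊝ x = A [ x ]≔ outside

⊹-⊝ : (A : Subset n) (x : Fin n) → lookup A x ≡ outside → A ⊹ x ⊝ x ≡ A
⊹-⊝ A x x∉A = trans ([]≔-idempotent A x) (trans (cong (A [ x ]≔_) (sym x∉A)) ([]≔-lookup A x))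

⊹-∈ : (A : Subset n) (x : Fin n) → lookup A x ≡ inside → A ⊹ x ≡ A
⊹-∈ A x x∈A = trans (cong (A [ x ]≔_) (sym x∈A)) ([]≔-lookup A x)

⊝-⊹ : (A : Subset n) (x : Fin n) → lookup A x ≡ inside → A ⊝ x ⊹ x ≡ A
⊝-⊹ A x x∈A = trans ([]≔-idempotent A x) (⊹-∈ A x x∈A)

∣⊹∣ : (A : Subset n) (x : Fin n) → lookup A x ≡ outside → ∣ A ⊹ x ∣ ≡ suc ∣ A ∣
∣⊹∣ (outside ∷ A) zero    _   = refl
∣⊹∣ (outside ∷ A) (suc x) x∉A = ∣⊹∣ A x x∉A
∣⊹∣ (inside  ∷ A) (suc x) x∉A = cong suc (∣⊹∣ A x x∉A)

χ∈ χ∉ : Subset n → Fin n → ℕ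
χ∈ A x = ι (lookup A x)
χ∉ A x = ι (not (lookup A x))

sum-χ∈ : (A : Subset n) → sum (χ∈ A) ≡ ∣ A ∣
sum-χ∈ []            = refl
sum-χ∈ (outside ∷ A) = sum-χ∈ A
sum-χ∈ (inside  ∷ A) = cong suc (sum-χ∈ A)

sum-χ∉ : (A : Subset n) → sum (χ∉ A) + ∣ A ∣ ≡ n
sum-χ∉ []            = refl
sum-χ∉ (outside ∷ A) = cong suc (sum-χ∉ A)
sum-χ∉ (inside  ∷ A) = trans (+-suc _ _) (cong suc (sum-χ∉ A))

-- Both sides sum `F` over the pairs (`A`, `B`) with `A` equal to `B` plus the one new vertex `x`;
-- the left is indexed by the larger set, the right by the smaller.
∑ˢ-flip : (F : Subset n → Subset n → ℕ) (x : Fin n) →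
          ∑ˢ (λ A → χ∈ A x * F A (A ⊝ x)) ≡ ∑ˢ (λ B → χ∉ B x * F (B ⊹ x) B)
-- The indicator kills the `outside` half on the left and the `inside` half on the right; the
-- surviving halves agree.
∑ˢ-flip {suc n} F zero = +-comm (∑ˢ {n} (λ _ → 0)) _
∑ˢ-flip {suc n} F (suc x) = cong₂ _+_
  (∑ˢ-flip (λ A B → F (outside ∷ A) (outside ∷ B)) x)
  (∑ˢ-flip (λ A B → F (inside ∷ A) (inside ∷ B)) x)

∑ˢ-sum-flip : (F : Subset n → Subset n → ℕ) →
              ∑ˢ (λ A → sum (λ x → χ∈ A x * F A (A ⊝ x))) ≡
              ∑ˢ (λ B → sum (λ x → χ∉ B x * F (B ⊹ x) B))
∑ˢ-sum-flip F = begin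
  ∑ˢ (λ A → sum (λ x → χ∈ A x * F A (A ⊝ x))) ≡⟨ ∑ˢ-sum-comm (λ A x → χ∈ A x * F A (A ⊝ x)) ⟩
  sum (λ x → ∑ˢ (λ A → χ∈ A x * F A (A ⊝ x))) ≡⟨ sum-cong-≗ (∑ˢ-flip F) ⟩
  sum (λ x → ∑ˢ (λ B → χ∉ B x * F (B ⊹ x) B)) ≡⟨ ∑ˢ-sum-comm (λ B x → χ∉ B x * F (B ⊹ x) B) ⟨
  ∑ˢ (λ B → sum (λ x → χ∉ B x * F (B ⊹ x) B)) ∎
  where open ≡-Reasoning

-- Each `A` in the support of `f` arises as `B ⊹ x` once for each of its `r` elements `x`.
∑ˢ-degree : ∀ r (f : Subset n → ℕ) → (∀ A → ∣ A ∣ ≢ r → f A ≡ 0) →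
            ∑ˢ (λ B → sum (λ x → χ∉ B x * f (B ⊹ x))) ≡ r * ∑ˢ f
∑ˢ-degree r f supp = begin
  ∑ˢ (λ B → sum (λ x → χ∉ B x * f (B ⊹ x))) ≡⟨ ∑ˢ-sum-flip (λ A _ → f A) ⟨
  ∑ˢ (λ A → sum (λ x → χ∈ A x * f A))       ≡⟨ ∑ˢ-cong size ⟩
  ∑ˢ (λ A → r * f A) ≡⟨ *-distribˡ-∑ˢ r f ⟩
  r * ∑ˢ f ∎
  where
  open ≡-Reasoning
  size : ∀ A → sum (λ x → χ∈ A x * f A) ≡ r * f A
  size A = trans (sym (*-distribʳ-sum (f A) (χ∈ A))) (trans (cong (_* f A) (sum-χ∈ A)) weigh)
    where
    weigh : ∣ A ∣ * f A ≡ r * f A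
    weigh with ∣ A ∣ ≟ r
    ... | yes eq = cong (_* f A) eq
    ... | no neq rewrite supp A neq = trans (*-zeroʳ ∣ A ∣) (sym (*-zeroʳ r))

level : ℕ → Subset n → ℕ
level r A = ι (does (∣ A ∣ ≟ r))

level-≡ : ∀ {r} {A : Subset n} → ∣ A ∣ ≡ r → level r A ≡ 1
level-≡ {r = r} {A} eq = cong ι (dec-true (∣ A ∣ ≟ r) eq)

level-≢ : ∀ {r} {A : Subset n} → ∣ A ∣ ≢ r → level r A ≡ 0
level-≢ {r = r} {A} neq = cong ι (dec-false (∣ A ∣ ≟ r) neq)

nC0≡1 : ∀ n → n C 0 ≡ 1
nC0≡1 zero    = refl
nC0≡1 (suc n) = refl

-- Splitting by the first vertex turns this into Pascal's rule.
∑ˢ-level : ∀ n r → ∑ˢ {n} (level r) ≡ n C r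
∑ˢ-level zero    zero    = refl
∑ˢ-level zero    (suc r) = refl
∑ˢ-level (suc n) zero    =
  trans (cong₂ _+_ (∑ˢ-level n 0) (∑ˢ-zero {n})) (trans (+-identityʳ _) (nC0≡1 n))
∑ˢ-level (suc n) (suc r) =
  trans (cong₂ _+_ (∑ˢ-level n (suc r)) (∑ˢ-level n r))
        (trans (+-comm (n C suc r) _) (nCk+nC[k+1]≡[n+1]C[k+1] n r))

-- Arithmetic for de Caen's bound.

2xy≤x²+y² : ∀ x y → 2 * (x * y) ≤ x * x + y * y
2xy≤x²+y² x y with ≤-total x y
... | inj₁ x≤y = subst (λ y → 2 * (x * y) ≤ x * x + y * y) (m+[n∸m]≡n x≤y) (ordered x (y ∸ x))
  where
  expand : ∀ x e → 2 * (x * (x + e)) + e * e ≡ x * x + (x + e) * (x + e)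
  expand = solve-∀
  ordered : ∀ x e → 2 * (x * (x + e)) ≤ x * x + (x + e) * (x + e)
  ordered x e = subst (2 * (x * (x + e)) ≤_) (expand x e) (m≤m+n _ _)
... | inj₂ y≤x = subst (λ x → 2 * (x * y) ≤ x * x + y * y) (m+[n∸m]≡n y≤x) (ordered y (x ∸ y))
  where
  expand : ∀ y e → 2 * ((y + e) * y) + e * e ≡ (y + e) * (y + e) + y * y
  expand = solve-∀
  ordered : ∀ y e → 2 * ((y + e) * y) ≤ (y + e) * (y + e) + y * y
  ordered y e = subst (2 * ((y + e) * y) ≤_) (expand y e) (m≤m+n _ _)

-- The tangent to d D along d + D = m + 1 at D = m / r, the mean value of D in the extremal case.
tangent : ∀ r m d D → d + D ≡ suc m →
          r * r * (d * D) + 2 * (r * m * D) ≤ r * r * (suc m * D) + m * m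
tangent r m d D eq = begin
  r * r * (d * D) + 2 * (r * m * D)           ≡⟨ lhs r m d D ⟩
  r * r * (d * D) + 2 * (r * D * m)           ≤⟨ +-monoʳ-≤ (r * r * (d * D)) (2xy≤x²+y² (r * D) m) ⟩
  r * r * (d * D) + (r * D * (r * D) + m * m) ≡⟨ rhs r m d D ⟩
  r * r * ((d + D) * D) + m * m ≡⟨ cong (λ z → r * r * (z * D) + m * m) eq ⟩
  r * r * (suc m * D) + m * m ∎
  where
  open ≤-Reasoning
  lhs : ∀ r m d D → r * r * (d * D) + 2 * (r * m * D) ≡ r * r * (d * D) + 2 * (r * D * m)
  lhs = solve-∀
  rhs : ∀ r m d D → r * r * (d * D) + (r * D * (r * D) + m * m) ≡ r * r * ((d + D) * D) + m * m
  rhs = solve-∀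

-- Multiplied by m + 1, the hypothesis is r (r (m + 1) ∸ m) times the conclusion, up to a
-- summand common to both sides.  Here r = j + 1 and r (m + 1) ∸ m = j (m + 1) + 1.
solve-for-σ : ∀ j m c γ σ N → γ + σ ≡ c → suc m * N ≡ suc j * c →
              suc j * suc j * (m * γ) + 2 * (suc j * m * (suc j * σ)) ≤
                suc j * suc j * (suc m * (suc j * σ)) + m * m * N →
              m * c ≤ suc j * suc m * σ
solve-for-σ j m c γ σ N refl eq le =
  *-cancelˡ-≤ (suc (j * suc m)) (*-cancelˡ-≤ (suc j) (+-cancelʳ-≤ _ _ _ (begin
    suc j * (suc (j * suc m) * (m * (γ + σ))) + suc j * common j m γ σ
      ≡⟨ lhs j m γ σ ⟩
    suc m * (suc j * suc j * (m * γ) + 2 * (suc j * m * (suc j * σ)))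
      ≤⟨ *-monoʳ-≤ (suc m) le ⟩
    suc m * (suc j * suc j * (suc m * (suc j * σ)) + m * m * N)
      ≡⟨ regroup j m σ N ⟩
    suc m * (suc j * suc j * (suc m * (suc j * σ))) + m * m * (suc m * N)
      ≡⟨ cong (λ z → suc m * (suc j * suc j * (suc m * (suc j * σ))) + m * m * z) eq ⟩
    suc m * (suc j * suc j * (suc m * (suc j * σ))) + m * m * (suc j * (γ + σ))
      ≡⟨ rhs j m γ σ ⟩
    suc j * (suc (j * suc m) * (suc j * suc m * σ)) + suc j * common j m γ σ ∎)))
  where
  open ≤-Reasoning
  common : ℕ → ℕ → ℕ → ℕ → ℕ
  common j m γ σ = suc (j * suc m) * m * σ + m * m * γ + 2 * (m * m * σ)
  lhs : ∀ j m γ σ →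
        suc j * (suc (j * suc m) * (m * (γ + σ))) +
          suc j * (suc (j * suc m) * m * σ + m * m * γ + 2 * (m * m * σ)) ≡
        suc m * (suc j * suc j * (m * γ) + 2 * (suc j * m * (suc j * σ)))
  lhs = solve-∀
  regroup : ∀ j m σ N →
            suc m * (suc j * suc j * (suc m * (suc j * σ)) + m * m * N) ≡
            suc m * (suc j * suc j * (suc m * (suc j * σ))) + m * m * (suc m * N)
  regroup = solve-∀
  rhs : ∀ j m γ σ →
        suc m * (suc j * suc j * (suc m * (suc j * σ))) + m * m * (suc j * (γ + σ)) ≡
        suc j * (suc (j * suc m) * (suc j * suc m * σ)) +
          suc j * (suc (j * suc m) * m * σ + m * m * γ + 2 * (m * m * σ))
  rhs = solve-∀

-- De Caen's bound for a family `𝒮` that contains a facet of every (r + 1)-set, where r = `suc j`.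

module _ {𝒮 : Pred (Subset n) ℓ} (𝒮? : Decidable 𝒮) (j m : ℕ) (n≡r+m : suc j + m ≡ n)
         (hit : ∀ e → ∣ e ∣ ≡ suc (suc j) → ∃ λ x → x ∈ e × 𝒮 (e ⊝ x)) where

  private
    -- `s` and `g` are the indicators of the r-sets inside and outside `𝒮`. `D B` and `d B` count
    -- the r-sets of each kind that extend `B` by one vertex, so both vanish unless `B` has size
    -- `j`.
    s g D d : Subset n → ℕ
    s A = level (suc j) A * ι (does (𝒮? A))
    g A = level (suc j) A * ι (not (does (𝒮? A)))
    D B = sum λ x → χ∉ B x * s (B ⊹ x)
    d B = sum λ x → χ∉ B x * g (B ⊹ x)

    g+s : ∀ A → g A + s A ≡ level (suc j) A
    g+s A = begin
      g A + s A
        ≡⟨ *-distribˡ-+ (level (suc j) A) _ _ ⟨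
      level (suc j) A * (ι (not (does (𝒮? A))) + ι (does (𝒮? A)))
        ≡⟨ cong (level (suc j) A *_)
             (trans (+-comm (ι (not (does (𝒮? A)))) _) (ι-+-not (does (𝒮? A)))) ⟩
      level (suc j) A * 1 ≡⟨ *-identityʳ _ ⟩
      level (suc j) A ∎
      where open ≡-Reasoning

    d+D : ∀ B → d B + D B ≡ level j B * sum (χ∉ B)
    d+D B = begin
      d B + D B
        ≡⟨ ∑-distrib-+ (λ x → χ∉ B x * g (B ⊹ x)) _ ⟨
      sum (λ x → χ∉ B x * g (B ⊹ x) + χ∉ B x * s (B ⊹ x)) ≡⟨ sum-cong-≗ term ⟩
      sum (λ x → level j B * χ∉ B x) ≡⟨ *-distribˡ-sum (level j B) (χ∉ B) ⟨
      level j B * sum (χ∉ B) ∎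
      where
      open ≡-Reasoning
      term : ∀ x → χ∉ B x * g (B ⊹ x) + χ∉ B x * s (B ⊹ x) ≡ level j B * χ∉ B x
      term x with lookup B x in x∉B
      ... | true  = sym (*-zeroʳ (level j B))
      ... | false = begin
        1 * g (B ⊹ x) + 1 * s (B ⊹ x)
          ≡⟨ cong₂ _+_ (*-identityˡ (g (B ⊹ x))) (*-identityˡ (s (B ⊹ x))) ⟩
        g (B ⊹ x) + s (B ⊹ x)         ≡⟨ g+s (B ⊹ x) ⟩
        level (suc j) (B ⊹ x)         ≡⟨ cong (λ z → ι (does (z ≟ suc j))) (∣⊹∣ B x x∉B) ⟩
        level j B ≡⟨ *-identityʳ _ ⟨
        level j B * 1 ∎

    codegree : (B : Subset n) → ∣ B ∣ ≡ j → sum (χ∉ B) ≡ suc m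
    codegree B refl = +-cancelʳ-≡ j _ _
      (trans (sum-χ∉ B) (trans (sym n≡r+m) (cong suc (+-comm j m))))

    -- The factor `level j B` confines the constant term of the tangent to the (r ∸ 1)-sets, so that
    -- the inequality can be summed over all subsets.
    pointwise : (B : Subset n) → suc j * suc j * (d B * D B) + 2 * (suc j * m * D B) ≤
                      suc j * suc j * (suc m * D B) + m * m * level j B
    pointwise B with ∣ B ∣ ≟ j
    ... | yes size = subst (λ z → suc j * suc j * (d B * D B) + 2 * (suc j * m * D B) ≤
                                  suc j * suc j * (suc m * D B) + z)
      (trans (sym (*-identityʳ (m * m))) (cong (m * m *_) (sym (level-≡ {A = B} size))))
      (tangent (suc j) m (d B) (D B) (trans (d+D B)
        (trans (cong₂ _*_ (level-≡ {A = B} size) (codegree B size)) (*-identityˡ _))))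
    -- Off level `j` the sum `d B + D B` is 0, so `D B` is 0 and the left side vanishes.
    ... | no ¬size
      rewrite m+n≡0⇒n≡0 (d B) (trans (d+D B) (cong (_* sum (χ∉ B)) (level-≢ {A = B} ¬size)))
            | *-zeroʳ (d B) | *-zeroʳ (suc j * m) | *-zeroʳ (suc j * suc j) = z≤n

    exchanges : Subset n → Fin n → Fin n → ℕ
    exchanges A y x = χ∈ A x * (χ∉ (A ⊝ x) y * s (A ⊝ x ⊹ y))

    -- Applied to `A ⊹ y`, the hypothesis `hit` yields a vertex `x` to delete, and the result is `A`
    -- with `x` exchanged for `y`.
    exchange : ∀ A → ∣ A ∣ ≡ suc j → ¬ 𝒮 A → ∀ y → χ∉ A y ≤ sum (exchanges A y)
    exchange A size A∉𝒮 y with lookup A y in y∉A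
    ... | true  = z≤n
    ... | false with hit (A ⊹ y) (trans (∣⊹∣ A y y∉A) (cong suc size))
    ... | x , x∈A⊹y , hitting = ≤-trans (≤-reflexive (sym one)) (term≤sum (exchanges A y) x)
      where
      x≢y : x ≢ y
      -- Deleting `y` again would give back `A`, which is not in `𝒮`.
      x≢y refl = A∉𝒮 (subst 𝒮 (⊹-⊝ A x y∉A) hitting)

      x∈A : lookup A x ≡ inside
      x∈A = trans (sym (lookup∘update′ x≢y A inside)) ([]=⇒lookup x∈A⊹y)

      y∉A⊝x : lookup (A ⊝ x) y ≡ outside
      y∉A⊝x = trans (lookup∘update′ (x≢y ∘ sym) A outside) y∉A

      swapped : A ⊝ x ⊹ y ≡ A ⊹ y ⊝ x
      swapped = []≔-commutes A x y x≢y

      size′ : ∣ A ⊝ x ⊹ y ∣ ≡ suc j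
      size′ = trans (∣⊹∣ (A ⊝ x) y y∉A⊝x)
        (trans (sym (∣⊹∣ (A ⊝ x) x (lookup∘update x A outside)))
          (trans (cong ∣_∣ (⊝-⊹ A x x∈A)) size))

      one : exchanges A y x ≡ 1
      one = cong₂ _*_ (cong ι x∈A) (cong₂ _*_ (cong (ι ∘ not) y∉A⊝x)
        (cong₂ _*_ (level-≡ {A = A ⊝ x ⊹ y} size′)
          (cong ι (dec-true (𝒮? (A ⊝ x ⊹ y)) (subst 𝒮 (sym swapped) hitting)))))

    -- An r-set has `m` vertices outside it, and by `exchange` each of them can enter some exchange.
    -- Grouped by the deleted vertex `x`, the exchanges are counted by `D (A ⊝ x)`.
    noncovered : ∀ A → m * g A ≤ sum (λ x → χ∈ A x * (g A * D (A ⊝ x)))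
    noncovered A with ∣ A ∣ ≟ suc j | 𝒮? A
    ... | no ¬size | _     rewrite level-≢ {A = A} ¬size | *-zeroʳ m = z≤n
    ... | yes size | yes _ rewrite level-≡ {A = A} size  | *-zeroʳ m = z≤n
    ... | yes size | no A∉𝒮 rewrite level-≡ {A = A} size = begin
      m * 1 ≡⟨ *-identityʳ m ⟩
      m ≡⟨ outer ⟨
      sum (χ∉ A) ≤⟨ sum-mono-≤ (exchange A size A∉𝒮) ⟩
      sum (λ y → sum (λ x → exchanges A y x))       ≡⟨ ∑-comm (exchanges A) ⟩
      sum (λ x → sum (λ y → exchanges A y x))
        ≡⟨ sum-cong-≗ (λ x → *-distribˡ-sum (χ∈ A x) (λ y → χ∉ (A ⊝ x) y * s (A ⊝ x ⊹ y))) ⟨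
      sum (λ x → χ∈ A x * D (A ⊝ x))
        ≡⟨ sum-cong-≗ (λ x → cong (χ∈ A x *_) (*-identityˡ (D (A ⊝ x)))) ⟨
      sum (λ x → χ∈ A x * (1 * D (A ⊝ x))) ∎
      where
      open ≤-Reasoning
      outer : sum (χ∉ A) ≡ m
      outer = +-cancelʳ-≡ (suc j) _ _ (trans (cong (sum (χ∉ A) +_) (sym size))
        (trans (sum-χ∉ A) (trans (sym n≡r+m) (+-comm (suc j) m))))

    exchange-count : m * ∑ˢ g ≤ ∑ˢ (λ B → d B * D B)
    exchange-count = begin
      m * ∑ˢ g ≡⟨ *-distribˡ-∑ˢ m g ⟨
      ∑ˢ (λ A → m * g A) ≤⟨ ∑ˢ-mono-≤ noncovered ⟩
      -- The flip regroups the exchanges by the common (r ∸ 1)-set `B`; the `d B` choices of the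
      -- outside set and the `D B` choices of the family member are independent.
      ∑ˢ (λ A → sum (λ x → χ∈ A x * (g A * D (A ⊝ x))))       ≡⟨ ∑ˢ-sum-flip (λ A B → g A * D B) ⟩
      ∑ˢ (λ B → sum (λ x → χ∉ B x * (g (B ⊹ x) * D B)))
        ≡⟨ ∑ˢ-cong (λ (B : Subset n) → sum-cong-≗ (λ x → *-assoc (χ∉ B x) (g (B ⊹ x)) (D B))) ⟨
      ∑ˢ (λ B → sum (λ x → χ∉ B x * g (B ⊹ x) * D B))
        ≡⟨ ∑ˢ-cong (λ B → *-distribʳ-sum (D B) (λ x → χ∉ B x * g (B ⊹ x))) ⟨
      ∑ˢ (λ B → d B * D B) ∎
      where open ≤-Reasoning

    ∑ˢ-D : ∑ˢ D ≡ suc j * ∑ˢ s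
    ∑ˢ-D = ∑ˢ-degree (suc j) s (λ A ¬size → cong (_* ι (does (𝒮? A))) (level-≢ {A = A} ¬size))

    -- Double count of the pairs of an (r ∸ 1)-set inside an r-set: `suc m` extensions upwards,
    -- `suc j` facets downwards.
    lower-level : suc m * ∑ˢ {n} (level j) ≡ suc j * (n C suc j)
    lower-level = begin
      suc m * ∑ˢ {n} (level j)
        ≡⟨ *-distribˡ-∑ˢ (suc m) (level {n} j) ⟨
      ∑ˢ {n} (λ B → suc m * level j B) ≡⟨ ∑ˢ-cong level-degree ⟩
      ∑ˢ {n} (λ B → sum (λ x → χ∉ B x * level (suc j) (B ⊹ x)))
        ≡⟨ ∑ˢ-degree {n} (suc j) (level (suc j)) (λ A → level-≢ {A = A}) ⟩
      suc j * ∑ˢ {n} (level (suc j))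
        ≡⟨ cong (suc j *_) (∑ˢ-level n (suc j)) ⟩
      suc j * (n C suc j) ∎
      where
      open ≡-Reasoning
      level-degree : (B : Subset n) → suc m * level j B ≡ sum (λ x → χ∉ B x * level (suc j) (B ⊹ x))
      level-degree B = begin
        suc m * level j B ≡⟨ scale ⟩
        sum (χ∉ B) * level j B
          ≡⟨ *-distribʳ-sum (level j B) (χ∉ B) ⟩
        sum (λ x → χ∉ B x * level j B) ≡⟨ sum-cong-≗ term ⟩
        sum (λ x → χ∉ B x * level (suc j) (B ⊹ x)) ∎
        where
        scale : suc m * level j B ≡ sum (χ∉ B) * level j B
        scale with ∣ B ∣ ≟ j
        ... | yes size = cong (_* level j B) (sym (codegree B size))
        ... | no ¬size rewrite level-≢ {A = B} ¬size =
          trans (*-zeroʳ (suc m)) (sym (*-zeroʳ (sum (χ∉ B))))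
        term : ∀ x → χ∉ B x * level j B ≡ χ∉ B x * level (suc j) (B ⊹ x)
        term x with lookup B x in x∉B
        ... | true  = refl
        ... | false = cong (λ z → 1 * ι (does (z ≟ suc j))) (sym (∣⊹∣ B x x∉B))

  deCaen : m * (n C suc j) ≤ suc j * suc m * ∑ˢ (λ A → level (suc j) A * ι (does (𝒮? A)))
  -- Here γ and σ are the numbers of r-sets outside and inside the family, and N is the number of
  -- all (r ∸ 1)-sets.
  deCaen = solve-for-σ j m (n C suc j) (∑ˢ g) (∑ˢ s) (∑ˢ {n} (level j))
    (trans (sym (∑ˢ-distrib-+ g s)) (trans (∑ˢ-cong g+s) (∑ˢ-level n (suc j)))) lower-level (begin
      r² * (m * ∑ˢ g) + 2 * (suc j * m * (suc j * ∑ˢ s))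
        ≤⟨ +-monoˡ-≤ _ (*-monoʳ-≤ r² exchange-count) ⟩
      r² * ∑ˢ (λ B → d B * D B) + 2 * (suc j * m * (suc j * ∑ˢ s))
        ≡⟨ cong₂ _+_ (sym (*-distribˡ-∑ˢ r² (λ B → d B * D B)))
             (trans (cong (λ z → 2 * (suc j * m * z)) (sym ∑ˢ-D))
               (trans (cong (2 *_) (sym (*-distribˡ-∑ˢ (suc j * m) D)))
                 (sym (*-distribˡ-∑ˢ 2 (λ B → suc j * m * D B))))) ⟩
      ∑ˢ (λ B → r² * (d B * D B)) + ∑ˢ (λ B → 2 * (suc j * m * D B))
        ≡⟨ ∑ˢ-distrib-+ (λ B → r² * (d B * D B)) _ ⟨
      ∑ˢ (λ B → r² * (d B * D B) + 2 * (suc j * m * D B))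
        ≤⟨ ∑ˢ-mono-≤ pointwise ⟩
      ∑ˢ (λ B → r² * (suc m * D B) + m * m * level j B)
        ≡⟨ ∑ˢ-distrib-+ (λ B → r² * (suc m * D B)) _ ⟩
      ∑ˢ (λ B → r² * (suc m * D B)) + ∑ˢ {n} (λ B → m * m * level j B)
        ≡⟨ cong₂ _+_ (trans (*-distribˡ-∑ˢ r² (λ B → suc m * D B))
             (cong (r² *_) (trans (*-distribˡ-∑ˢ (suc m) D) (cong (suc m *_) ∑ˢ-D))))
             (*-distribˡ-∑ˢ {n} (m * m) (level j)) ⟩
      r² * (suc m * (suc j * ∑ˢ s)) + m * m * ∑ˢ {n} (level j) ∎)
    where
    open ≤-Reasoning
    r² = suc j * suc j

-- Counting the sets covered by an edge.

_≟ˢ_ : DecidableEquality (Subset n)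
_≟ˢ_ = ≡-dec Bool._≟_

∑ˢ-≟ : (B : Subset n) → ∑ˢ (λ A → ι (does (A ≟ˢ B))) ≡ 1
∑ˢ-≟ B = trans
  (∑ˢ-single _ B (λ A A≢B → cong ι (dec-false (A ≟ˢ B) A≢B)))
  (cong ι (dec-true (B ≟ˢ B) refl))

_∈ᴸ?_ : (A : Subset n) (E : List (Subset n)) → _
_∈ᴸ?_ {n} = DecMembership._∈?_ (_≟ˢ_ {n})

∑ˢ-∈ᴸ : (E : List (Subset n)) → ∑ˢ (λ A → ι (does (A ∈ᴸ? E))) ≤ length E
∑ˢ-∈ᴸ {n} []  = ≤-reflexive (∑ˢ-zero {n})
∑ˢ-∈ᴸ (e ∷ E) = begin
  ∑ˢ (λ A → ι (does (A ∈ᴸ? (e ∷ E)))) ≤⟨ ∑ˢ-mono-≤ union ⟩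
  ∑ˢ (λ A → ι (does (A ≟ˢ e)) + ι (does (A ∈ᴸ? E)))
    ≡⟨ ∑ˢ-distrib-+ (λ A → ι (does (A ≟ˢ e))) _ ⟩
  ∑ˢ (λ A → ι (does (A ≟ˢ e))) + ∑ˢ (λ A → ι (does (A ∈ᴸ? E)))
    ≤⟨ +-mono-≤ (≤-reflexive (∑ˢ-≟ e)) (∑ˢ-∈ᴸ E) ⟩
  suc (length E) ∎
  where
  open ≤-Reasoning
  union : ∀ A → ι (does (A ∈ᴸ? (e ∷ E))) ≤ ι (does (A ≟ˢ e)) + ι (does (A ∈ᴸ? E))
  union A with does (A ≟ˢ e)
  ... | true  = s≤s z≤n
  ... | false = ≤-refl

-- The covering edge is presented as `A` plus one new vertex, so that a search over vertices decides
-- the property and `∑ˢ-degree` counts the incidences.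
Covered : List (Subset n) → Subset n → Set
Covered E A = ∃ λ x → lookup A x ≡ outside × (A ⊹ x) ∈ᴸ E

covered? : (E : List (Subset n)) → Decidable (Covered E)
covered? E A = any? λ x → (lookup A x Bool.≟ outside) ×-dec ((A ⊹ x) ∈ᴸ? E)

-- Every covered set lies in at least one pair of a set and an edge extending it by a vertex, and
-- each edge lies in exactly `k` such pairs.
∑ˢ-covered : ∀ {k r} (E : List (Subset n)) → All (λ e → ∣ e ∣ ≡ k) E →
             ∑ˢ (λ A → level r A * ι (does (covered? E A))) ≤ k * length E
∑ˢ-covered {k = k} {r} E uniform = begin
  ∑ˢ (λ A → level r A * ι (does (covered? E A))) ≤⟨ ∑ˢ-mono-≤ count ⟩
  ∑ˢ (λ A → sum (λ x → χ∉ A x * ι (does ((A ⊹ x) ∈ᴸ? E))))           ≡⟨ ∑ˢ-degree k _ supp ⟩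
  k * ∑ˢ (λ e → ι (does (e ∈ᴸ? E))) ≤⟨ *-monoʳ-≤ k (∑ˢ-∈ᴸ E) ⟩
  k * length E ∎
  where
  open ≤-Reasoning
  supp : ∀ e → ∣ e ∣ ≢ k → ι (does (e ∈ᴸ? E)) ≡ 0
  supp e ¬size = cong ι (dec-false (e ∈ᴸ? E) (¬size ∘ All.lookup uniform))
  ι≤1 : ∀ b → ι b ≤ 1
  ι≤1 true  = ≤-refl
  ι≤1 false = z≤n
  count : ∀ A → level r A * ι (does (covered? E A)) ≤ sum (λ x → χ∉ A x * ι (does ((A ⊹ x) ∈ᴸ? E)))
  count A with covered? E A
  ... | no _ = ≤-trans (≤-reflexive (*-zeroʳ (level r A))) z≤n
  ... | yes (x , x∉A , A⊹x∈E) = begin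
    level r A * 1 ≤⟨ *-monoˡ-≤ 1 (ι≤1 (does (∣ A ∣ ≟ r))) ⟩
    1
      ≡⟨ cong₂ _*_ (cong (ι ∘ not) x∉A) (cong ι (dec-true ((A ⊹ x) ∈ᴸ? E) A⊹x∈E)) ⟨
    χ∉ A x * ι (does ((A ⊹ x) ∈ᴸ? E))
      ≤⟨ term≤sum (λ x → χ∉ A x * ι (does ((A ⊹ x) ∈ᴸ? E))) x ⟩
    sum (λ x → χ∉ A x * ι (does ((A ⊹ x) ∈ᴸ? E))) ∎

-- Vertex sequences and their windows.

⁅x⁆∪A≡A⊹x : (x : Fin n) (A : Subset n) → ⁅ x ⁆ ∪ A ≡ A ⊹ x
⁅x⁆∪A≡A⊹x zero    (b ∷ A) = cong (inside ∷_) (∪-identityˡ A)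
⁅x⁆∪A≡A⊹x (suc x) (b ∷ A) = cong (b ∷_) (⁅x⁆∪A≡A⊹x x A)

∣⊹∣≤ : (A : Subset n) (x : Fin n) → ∣ A ⊹ x ∣ ≤ suc ∣ A ∣
∣⊹∣≤ A x with lookup A x in eq
... | true  = ≤-trans (≤-reflexive (cong ∣_∣ (⊹-∈ A x eq))) (n≤1+n _)
... | false = ≤-reflexive (∣⊹∣ A x eq)

∣⊹∣>⇒∉ : (A : Subset n) (x : Fin n) → ∣ A ∣ < ∣ A ⊹ x ∣ → lookup A x ≡ outside
∣⊹∣>⇒∉ A x A<A⊹x with lookup A x in eq
... | false = refl
... | true  = contradiction (cong ∣_∣ (sym (⊹-∈ A x eq))) (<⇒≢ A<A⊹x)

nonempty : (A : Subset n) → ∀ {m} → ∣ A ∣ ≡ suc m → ∃ λ x → lookup A x ≡ inside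
nonempty (inside  ∷ A) _    = zero , refl
nonempty (outside ∷ A) size with nonempty A size
... | x , x∈A = suc x , x∈A

∣toSubset∣≤length : (s : List (Fin n)) → ∣ toSubset s ∣ ≤ length s
∣toSubset∣≤length {n} [] = ≤-reflexive (∣⊥∣≡0 n)
∣toSubset∣≤length (x ∷ s) rewrite ⁅x⁆∪A≡A⊹x x (toSubset s) =
  ≤-trans (∣⊹∣≤ (toSubset s) x) (s≤s (∣toSubset∣≤length s))

toSubset-∷ʳ : (s : List (Fin n)) (y : Fin n) → toSubset (s ∷ʳ y) ≡ toSubset s ⊹ y
toSubset-∷ʳ s y = trans (swap s) (⁅x⁆∪A≡A⊹x y (toSubset s))
  where
  swap : ∀ s → toSubset (s ∷ʳ y) ≡ ⁅ y ⁆ ∪ toSubset s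
  swap []      = refl
  swap (x ∷ s) = trans (cong (⁅ x ⁆ ∪_) (swap s))
    (trans (sym (∪-assoc ⁅ x ⁆ ⁅ y ⁆ _))
      (trans (cong (_∪ toSubset s) (∪-comm ⁅ x ⁆ ⁅ y ⁆)) (∪-assoc ⁅ y ⁆ ⁅ x ⁆ _)))

last∈toSubset : (s : List (Fin n)) {x : Fin n} → last s ≡ just x → x ∈ toSubset s
last∈toSubset (x ∷ [])    refl = x∈p∪q⁺ (inj₁ (x∈⁅x⁆ x))
last∈toSubset (y ∷ z ∷ s) eq   = x∈p∪q⁺ {p = ⁅ y ⁆} (inj₂ (last∈toSubset (z ∷ s) eq))

-- The first entry occurs again at the end, so it adds nothing to the set of the remaining entries.
∣closed∣<length : (s : List (Fin n)) → 2 ≤ length s → head s ≡ last s → ∣ toSubset s ∣ < length s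
∣closed∣<length (x ∷ []) (s≤s ()) _
∣closed∣<length (x ∷ y ∷ s) _ closed rewrite ⁅x⁆∪A≡A⊹x x (toSubset (y ∷ s)) =
  s≤s (≤-trans (≤-reflexive (cong ∣_∣ same)) (∣toSubset∣≤length (y ∷ s)))
  where
  T = toSubset (y ∷ s)
  same : T ⊹ x ≡ T
  same = ⊹-∈ T x ([]=⇒lookup (last∈toSubset (y ∷ s) (sym closed)))

window : ℕ → List (Fin n) → ℕ → Subset n
window k s i = toSubset (take k (drop i s))

-- The vertices `x` and `y` may coincide; where the two sets must differ, the distinctness of
-- windows supplies it.
Adjacent : Subset n → Subset n → Set
Adjacent e f = ∃ λ A → ∃ λ x → ∃ λ y →
  e ≡ A ⊹ x × f ≡ A ⊹ y × lookup A x ≡ outside × lookup A y ≡ outside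

Adjacent-sym : {e f : Subset n} → Adjacent e f → Adjacent f e
Adjacent-sym (A , x , y , e≡ , f≡ , x∉A , y∉A) = A , y , x , f≡ , e≡ , y∉A , x∉A

-- Consecutive windows share `r` entries, which form the common set `A`; the first window adds the
-- entry before them and the second the entry after them.
window-adjacent : ∀ r i (s : List (Fin n)) → suc (i + suc r) ≤ length s →
                  ∣ window (suc r) s i ∣ ≡ suc r → ∣ window (suc r) s (suc i) ∣ ≡ suc r →
                  Adjacent (window (suc r) s i) (window (suc r) s (suc i))
window-adjacent r (suc i) (x ∷ s) (s≤s i+r<l) size size′ = window-adjacent r i s i+r<l size size′
window-adjacent r zero    (x ∷ s) (s≤s r<l)   size size′ =
  A , x , y , first , second , ∣⊹∣>⇒∉ A x (larger first size) , ∣⊹∣>⇒∉ A y (larger second size′)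
  where
  y = List.lookup s (fromℕ< r<l)
  A = toSubset (take r s)
  first : toSubset (take (suc r) (x ∷ s)) ≡ A ⊹ x
  first = ⁅x⁆∪A≡A⊹x x A
  second : toSubset (take (suc r) s) ≡ A ⊹ y
  second = trans (cong toSubset snoc) (toSubset-∷ʳ (take r s) y)
    where
    snoc : take (suc r) s ≡ take r s ∷ʳ y
    snoc = subst (λ z → take (suc z) s ≡ take z s ∷ʳ y) (toℕ-fromℕ< r<l) (take-suc s (fromℕ< r<l))
  -- `A` comes from at most `r` entries, so a window of full size `suc r` forces its extra vertex to
  -- be new.
  larger : ∀ {e z} → e ≡ A ⊹ z → ∣ e ∣ ≡ suc r → ∣ A ∣ < ∣ A ⊹ z ∣
  larger e≡ size = ≤-trans
    (s≤s (≤-trans (∣toSubset∣≤length (take r s))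
      (≤-trans (≤-reflexive (length-take r s)) (m⊓n≤m r _))))
    (≤-reflexive (trans (sym size) (cong ∣_∣ e≡)))

AllPairs-applyUpTo⁻ : ∀ {a ℓ} {X : Set a} {R : Rel X ℓ} (f : ℕ → X) l → AllPairs R (applyUpTo f l) →
                      ∀ {i j} → i < j → j < l → R (f i) (f j)
AllPairs-applyUpTo⁻ f (suc l) (px ∷ pxs) {zero}  {suc j} _         (s≤s j<l) =
  All.applyUpTo⁻ (f ∘ suc) l px j<l
AllPairs-applyUpTo⁻ f (suc l) (px ∷ pxs) {suc i} {suc j} (s≤s i<j) (s≤s j<l) =
  AllPairs-applyUpTo⁻ (f ∘ suc) l pxs i<j j<l

-- The common part `A` is a facet of `e`, and `f` is the edge that covers it.
covered-facet : {E : List (Subset n)} {e f : Subset n} → Adjacent e f → f ∈ᴸ E →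
                ∃ λ x → x ∈ e × Covered E (e ⊝ x)
covered-facet {E = E} (A , x , y , refl , refl , x∉A , y∉A) f∈E =
  x , lookup⇒[]= x (A ⊹ x) (lookup∘update x A inside) ,
  subst (Covered E) (sym (⊹-⊝ A x x∉A)) (y , y∉A , f∈E)

-- Semicycles after adding a set `e` none of whose facets is covered.

module _ {n r : ℕ} (F : Hypergraph (suc (suc r)) n) (e : Subset n)
         (uncovered : ¬ ∃ λ x → x ∈ e × Covered (edges F) (e ⊝ x)) where

  private
    k : ℕ
    k = suc (suc r)

  -- If some window were `e`, a neighbouring window would be an edge of `F` covering a facet of `e`.
  -- Hence all windows are edges of `F`.
  semicycle-avoids : ∀ s → IsSemicycleIn k (e ∷ edges F) s → IsSemicycleIn k (edges F) s
  semicycle-avoids s ((k≤l , sizes , ins , uniq) , closed) = (k≤l , sizes , avoids , uniq) , closed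
    where
    L = length s ∸ k
    W = window k s

    windows≡ : windows k s ≡ applyUpTo W (suc L)
    windows≡ = map-upTo W (suc L)

    sizeAt : ∀ {i} → i ≤ L → ∣ W i ∣ ≡ k
    sizeAt i≤L = All.applyUpTo⁻ W (suc L) (subst (All _) windows≡ sizes) (s≤s i≤L)

    inAt : ∀ {i} → i ≤ L → W i ∈ᴸ (e ∷ edges F)
    inAt i≤L = All.applyUpTo⁻ W (suc L) (subst (All _) windows≡ ins) (s≤s i≤L)

    distinct : ∀ {i} → i < L → W i ≢ W (suc i)
    distinct i<L = AllPairs-applyUpTo⁻ W (suc L) (subst Unique windows≡ uniq) ≤-refl (s≤s i<L)

    -- With a single window the whole closed sequence would be that window, and its repeated vertex
    -- would leave fewer than `k` distinct ones.
    0<L : 0 < L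
    0<L = m<n⇒0<n∸m (≤∧≢⇒< k≤l λ k≡l → <-irrefl refl (begin-strict
      k ≡⟨ sizeAt z≤n ⟨
      ∣ toSubset (take k s) ∣ ≡⟨ cong (∣_∣ ∘ toSubset) (take-all k s (≤-reflexive (sym k≡l))) ⟩
      ∣ toSubset s ∣          <⟨ ∣closed∣<length s (≤-trans (s≤s (s≤s z≤n)) k≤l) closed ⟩
      length s ≡⟨ k≡l ⟨
      k ∎))
      where open ≤-Reasoning

    adjacent : ∀ {i} → i < L → Adjacent (W i) (W (suc i))
    adjacent {i} i<L = window-adjacent (suc r) i s
      (m≤o∸n⇒m+n≤o (suc i) k≤l i<L) (sizeAt (<⇒≤ i<L)) (sizeAt i<L)

    old : ∀ {i} → i ≤ L → W i ≢ e → W i ∈ᴸ edges F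
    old i≤L Wi≢e with inAt i≤L
    ... | here Wi≡e    = contradiction Wi≡e Wi≢e
    ... | there Wi∈F = Wi∈F

    avoid : ∀ i → i ≤ L → W i ≢ e
    -- The next window serves as neighbour, or the previous one if `W i` is the last; `0<L` excludes
    -- that window 0 is the last. The neighbour differs from `e` by uniqueness, so it is an old
    -- edge.
    avoid i i≤L Wi≡e with m≤n⇒m<n∨m≡n i≤L
    ... | inj₁ i<L = uncovered (covered-facet
      (subst (λ w → Adjacent w (W (suc i))) Wi≡e (adjacent i<L))
      (old i<L λ eq → distinct i<L (trans Wi≡e (sym eq))))
    avoid zero    i≤L Wi≡e | inj₂ 0≡L = contradiction 0≡L (<⇒≢ 0<L)
    avoid (suc i) i<L Wi≡e | inj₂ _   = uncovered (covered-facet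
      (subst (λ w → Adjacent w (W i)) Wi≡e (Adjacent-sym (adjacent i<L)))
      (old (<⇒≤ i<L) λ eq → distinct i<L (trans eq (sym Wi≡e))))

    avoids : All (_∈ᴸ edges F) (windows k s)
    avoids = subst (All _) (sym windows≡)
      (All.applyUpTo⁺₁ W (suc L) λ { {i} (s≤s i≤L) → old i≤L (avoid i i≤L) })

-- An edge covers its own facets. For a non-edge with no covered facet, adding it would create no
-- semicycle and keep all chains, so the result would be a hypertree, against maximality.
covered-facets : ∀ {n r} (F : Hypergraph (suc (suc r)) n) → IsEdgeMaximalHypertree F →
                 ∀ e → ∣ e ∣ ≡ suc (suc r) → ∃ λ x → x ∈ e × Covered (edges F) (e ⊝ x)
covered-facets {n} {r} F ((connected , acyclic) , maximal) e size with e ∈ᴸ? edges F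
... | yes e∈F with nonempty e size
...   | x , x∈e = x , lookup⇒[]= x e x∈e , x , lookup∘update x e outside ,
  subst (_∈ᴸ edges F) (sym (⊝-⊹ e x x∈e)) e∈F
covered-facets {n} {r} F ((connected , acyclic) , maximal) e size | no e∉F =
  -- The contradiction gives only a double negation; a finite search over the vertices turns it into
  -- a witness.
  decidable-stable (any? λ x → (x ∈? e) ×-dec covered? (edges F) (e ⊝ x)) λ uncovered →
    maximal e size e∉F (connected′ , λ s → acyclic s ∘ semicycle-avoids F e uncovered s)
  where
  connected′ : ChainConnected (addEdge F e size e∉F)
  connected′ u v u≢v with connected u v u≢v
  ... | s , ((k≤l , sizes , ins , uniq) , open′) , u∈s , v∈s =
    s , ((k≤l , sizes , All.map there ins , uniq) , open′) , u∈s , v∈s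

-- The bound appears with denominators cleared; `k ∸ 1 ≤ n` makes the truncated difference
-- `n ∸ (k ∸ 1)` equal to n - k + 1.
theorem13 : (k n : ℕ) → 2 ≤ k → k ∸ 1 ≤ n → (F : Hypergraph k n) →
    IsEdgeMaximalHypertree F →
    (n ∸ (k ∸ 1)) * (n C (k ∸ 1)) ≤ k * (k ∸ 1) * suc (n ∸ (k ∸ 1)) * length (edges F)
theorem13 (suc zero) n (s≤s ()) _ F maximal
theorem13 (suc (suc j)) n 2≤k r≤n F maximal = begin
  m * (n C suc j)
    ≤⟨ deCaen (covered? (edges F)) j m (m+[n∸m]≡n r≤n) (covered-facets F maximal) ⟩
  suc j * suc m * ∑ˢ (λ A → level (suc j) A * ι (does (covered? (edges F) A)))
    ≤⟨ *-monoʳ-≤ (suc j * suc m) (∑ˢ-covered (edges F) (uniform F)) ⟩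
  suc j * suc m * (suc (suc j) * length (edges F))
    ≡⟨ regroup (suc j) (suc m) (suc (suc j)) (length (edges F)) ⟩
  suc (suc j) * suc j * suc m * length (edges F) ∎
  where
  open ≤-Reasoning
  m = n ∸ suc j
  regroup : ∀ r m k l → r * m * (k * l) ≡ k * r * m * l
  regroup = solve-∀
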